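{- Let $m\in\mathbb N$, $M\in{\rm Mat}_m(\mathbb Z)$, and $n_1,n_2\in\mathbb N$ with $\gcd(n_1,n_2)=1$. Then $\Gamma_{M,\,n_1n_2}$ is isomorphic (as a directed graph) to the tensor product $\Gamma_{M,\,n_1}\times\Gamma_{M,\,n_2}$.
   Context: $\mathbb N$ is the set of positive integers and $\mathbb Z_n$ the integers modulo $n$. For $M\in{\rm Mat}_m(\mathbb Z)$, the move graph $\Gamma_{M,\,n}$ is the directed graph with vertex set $\mathbb Z_n^m$ and arc set $\{({\bf x},{\bf y}) : {\bf y}^T=M{\bf x}^T \text{ in } \mathbb Z_n^m\}$ (loops allowed). The tensor product $\Delta_1\times\Delta_2$ of directed graphs is the directed graph whose adjacency matrix is the Kronecker product of the adjacency matrices of $\Delta_1$ and $\Delta_2$; equivalently, its vertex set is $V(\Delta_1)\times V(\Delta_2)$ and $((u_1,u_2),(w_1,w_2))$ is an arc iff $(u_1,w_1)$ is an arc of $\Delta_1$ and $(u_2,w_2)$ is an arc of $\Delta_2$. -}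

module Defs where

open import Data.Fin.Base using (Fin; toℕ; fromℕ<)
open import Data.Integer.Base using (ℤ; 0ℤ; _%ℕ_)
open import Data.Integer.DivMod using (n%ℕd<d)
open import Data.Nat.Base as ℕ using (ℕ; NonZero)
open import Data.Nat.DivMod using (_mod_)
open import Data.Product.Base using (_×_)
open import Data.Product.Relation.Binary.Pointwise.NonDependent using (Pointwise)
open import Data.Vec.Base using (Vec; map; zipWith; foldr′)
open import Function.Bundles using (_↔_; _⇔_; Inverse)
open import Level using (0ℓ)
open import Relation.Binary.Core using (Rel)
open import Relation.Binary.PropositionalEquality.Core using (_≡_)

-- ℤ/n for n ≥ 1: each class is represented by its unique member in
-- {0, …, n-1}, so that equality of residue classes is _≡_ on Fin n.

ℤ/ : ℕ → Set
ℤ/ n = Fin n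

module _ {n : ℕ} .{{_ : NonZero n}} where

  infixl 6 _+ₙ_
  infixl 7 _*ₙ_

  -- _%ℕ_ takes its value in {0, …, n-1} for negative integers as well.
  [_]ₙ : ℤ → ℤ/ n
  [ z ]ₙ = fromℕ< (n%ℕd<d z n)

  0ₙ : ℤ/ n
  0ₙ = [ 0ℤ ]ₙ

  _+ₙ_ : ℤ/ n → ℤ/ n → ℤ/ n
  a +ₙ b = (toℕ a ℕ.+ toℕ b) mod n

  _*ₙ_ : ℤ/ n → ℤ/ n → ℤ/ n
  a *ₙ b = (toℕ a ℕ.* toℕ b) mod n

  dot : ∀ {m} → Vec (ℤ/ n) m → Vec (ℤ/ n) m → ℤ/ n
  dot u v = foldr′ _+ₙ_ 0ₙ (zipWith _*ₙ_ u v)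

-- Square matrices, as vectors of rows.
Mat : ℕ → Set → Set
Mat m A = Vec (Vec A m) m

-- The integer matrix acts on (ℤ/n)^m through the reduction of its entries.
infixr 7 _·_
_·_ : ∀ {m n} .{{_ : NonZero n}} → Mat m ℤ → Vec (ℤ/ n) m → Vec (ℤ/ n) m
M · x = map (λ row → dot (map [_]ₙ row) x) M

record DiGraph : Set₁ where
  field
    Vertex : Set
    Arc    : Rel Vertex 0ℓ

open DiGraph public

moveGraph : ∀ {m} → Mat m ℤ → (n : ℕ) .{{_ : NonZero n}} → DiGraph
moveGraph {m} M n = record
  { Vertex = Vec (ℤ/ n) m
  ; Arc    = λ x y → y ≡ M · x
  }

infixr 7 _⊗_
_⊗_ : DiGraph → DiGraph → DiGraph
G ⊗ H = record
  { Vertex = Vertex G × Vertex H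
  ; Arc    = Pointwise (Arc G) (Arc H)
  }

infix 4 _≅_
record _≅_ (G H : DiGraph) : Set where
  field
    vertices : Vertex G ↔ Vertex H
    arcs     : ∀ x y → Arc G x y ⇔ Arc H (Inverse.to vertices x) (Inverse.to vertices y)

{-# OPTIONS --safe #-}

-- By the Chinese remainder theorem, reduction of coordinates modulo n₁ and n₂
-- is a bijection from (ℤ/n₁n₂)^m to (ℤ/n₁)^m × (ℤ/n₂)^m. Reduction is a ring
-- homomorphism, so it commutes with the action of M; together with injectivity
-- this makes it preserve and reflect the arcs y = M x.

module Submission where

open import Defs
open import Data.Fin.Base using (toℕ)
open import Data.Fin.Properties using (toℕ-fromℕ<; toℕ-injective; toℕ<n)
open import Data.Integer.Base as ℤ using (ℤ; +_; _%ℕ_; _/ℕ_; _⊖_; ∣_∣)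
open import Data.Integer.DivMod using (n%ℕd<d; a≡a%ℕn+[a/ℕn]*n)
open import Data.Integer.Divisibility.Signed as ℤ∣ using (∣⇒∣ᵤ; ∣ᵤ⇒∣)
import Data.Integer.Properties as ℤ
import Data.Integer.Tactic.RingSolver as ℤ-Solver
open import Data.Nat.Base using (ℕ; NonZero; _+_; _*_; _<_; _%_; ≢-nonZero)
open import Data.Nat.Coprimality as Coprimality
  using (Coprime; gcd≡1⇒coprime; coprime-divisor; coprime-Bézout)
open import Data.Nat.Divisibility
  using (_∣_; divides; divides-refl; >⇒∤; *-monoʳ-∣; m∣m*n; n∣m*n; ∣n⇒∣m*n)
open import Data.Nat.DivMod
open import Data.Nat.GCD using (gcd; module Bézout)
open import Data.Nat.Properties using (m*n≢0; _≟_; ⊔-pres-<m; +-comm; *-comm; *-identityʳ; ≤-<-trans)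
open import Data.Nat.Tactic.RingSolver using (solve-∀)
open import Data.Product.Base using (∃-syntax; _×_; _,_; proj₁)
open import Data.Vec.Base using (Vec; []; _∷_; map; zipWith)
open import Data.Vec.Properties using (∷-injective; map-∘; map-cong)
open import Function.Bundles using (mk↔ₛ′; mk⇔)
open import Relation.Binary.PropositionalEquality.Core
  using (_≡_; refl; sym; trans; cong; cong₂; subst)
open import Relation.Binary.PropositionalEquality.Properties using (module ≡-Reasoning)
open import Relation.Nullary.Decidable using (yes; no)
open import Relation.Nullary.Negation using (contradiction)

open ≡-Reasoning

-- Divisibility of differences and equality of remainders.

∣∧<⇒≡0 : ∀ {d k} → d ∣ k → k < d → k ≡ 0
∣∧<⇒≡0 {k = k} d∣k k<d with k ≟ 0
... | yes k≡0 = k≡0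
... | no  k≢0 = contradiction d∣k (>⇒∤ {{≢-nonZero k≢0}} k<d)

-- The absolute value of `a ⊖ b` is at most the larger of `a` and `b`, hence below `d`, and the only
-- multiple of `d` below `d` is zero.
residue-unique : ∀ {d a b} → a < d → b < d → d ∣ ∣ a ⊖ b ∣ → a ≡ b
residue-unique {a = a} {b} a<d b<d d∣a⊖b =
  ℤ.+-injective (ℤ.i-j≡0⇒i≡j (+ a) (+ b) (trans (ℤ.m-n≡m⊖n a b)
    (ℤ.∣i∣≡0⇒i≡0 (∣∧<⇒≡0 d∣a⊖b (≤-<-trans (ℤ.∣m⊝n∣≤m⊔n a b) (⊔-pres-<m a<d b<d))))))

module _ (d : ℕ) .{{_ : NonZero d}} where

  -- Splits off a multiple of `d`, so that divisibility of `x - y` by `d` can be traded for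
  -- divisibility of the difference of remainders; both implications below rest on this.
  difference : ∀ x y → x ℤ.- y ≡ (+ (x %ℕ d) ℤ.- + (y %ℕ d)) ℤ.+ (x /ℕ d ℤ.- y /ℕ d) ℤ.* + d
  difference x y = begin
    x ℤ.- y
      ≡⟨ cong₂ ℤ._-_ (a≡a%ℕn+[a/ℕn]*n x d) (a≡a%ℕn+[a/ℕn]*n y d) ⟩
    (+ (x %ℕ d) ℤ.+ x /ℕ d ℤ.* + d) ℤ.- (+ (y %ℕ d) ℤ.+ y /ℕ d ℤ.* + d)
      ≡⟨ rearrange (+ (x %ℕ d)) (+ (y %ℕ d)) (x /ℕ d) (y /ℕ d) (+ d) ⟩
    (+ (x %ℕ d) ℤ.- + (y %ℕ d)) ℤ.+ (x /ℕ d ℤ.- y /ℕ d) ℤ.* + d ∎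
    where
    rearrange : ∀ r s p q e → (r ℤ.+ p ℤ.* e) ℤ.- (s ℤ.+ q ℤ.* e) ≡ (r ℤ.- s) ℤ.+ (p ℤ.- q) ℤ.* e
    rearrange = ℤ-Solver.solve-∀

  %ℕ-≡⇒∣ : ∀ x y → x %ℕ d ≡ y %ℕ d → + d ℤ∣.∣ x ℤ.- y
  %ℕ-≡⇒∣ x y eq = ℤ∣.divides (x /ℕ d ℤ.- y /ℕ d) (begin
    x ℤ.- y
      ≡⟨ difference x y ⟩
    (+ (x %ℕ d) ℤ.- + (y %ℕ d)) ℤ.+ q
      ≡⟨ cong (ℤ._+ q) (ℤ.i≡j⇒i-j≡0 (cong +_ eq)) ⟩
    ℤ.0ℤ ℤ.+ q
      ≡⟨ ℤ.+-identityˡ q ⟩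
    q ∎)
    where q = (x /ℕ d ℤ.- y /ℕ d) ℤ.* + d

  ∣⇒%ℕ-≡ : ∀ x y → + d ℤ∣.∣ x ℤ.- y → x %ℕ d ≡ y %ℕ d
  -- Removing the multiple of `d` from `x - y` leaves a difference of two remainders, both below
  -- `d`.
  ∣⇒%ℕ-≡ x y d∣x-y = residue-unique (n%ℕd<d x d) (n%ℕd<d y d)
    (subst (λ z → d ∣ ∣ z ∣) (ℤ.m-n≡m⊖n (x %ℕ d) (y %ℕ d))
      (∣⇒∣ᵤ (ℤ∣.∣m+n∣n⇒∣m {m = + (x %ℕ d) ℤ.- + (y %ℕ d)} (subst (+ d ℤ∣.∣_) (difference x y) d∣x-y)
        (ℤ∣.divides (x /ℕ d ℤ.- y /ℕ d) refl))))

  %-≡⇒∣⊖ : ∀ a b → a % d ≡ b % d → d ∣ ∣ a ⊖ b ∣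
  %-≡⇒∣⊖ a b eq = subst (λ z → d ∣ ∣ z ∣) (ℤ.m-n≡m⊖n a b) (∣⇒∣ᵤ (%ℕ-≡⇒∣ (+ a) (+ b) eq))

-- Reduction modulo a divisor of the modulus.

toℕ-mod : ∀ a n .{{_ : NonZero n}} → toℕ (a mod n) ≡ a % n
toℕ-mod a n = toℕ-fromℕ< (m%n<n a n)

toℕ-[] : ∀ z n .{{_ : NonZero n}} → toℕ ([_]ₙ {n} z) ≡ z %ℕ n
toℕ-[] z n = toℕ-fromℕ< (n%ℕd<d z n)

module Reduction (n d : ℕ) .{{_ : NonZero n}} .{{_ : NonZero d}} (d∣n : d ∣ n) where

  reduce : ℤ/ n → ℤ/ d
  reduce a = toℕ a mod d

  -- The multiple of `n` removed by the inner `mod` is also a multiple of `d`. This lets the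
  -- homomorphism laws be checked on natural representatives.
  reduce-mod : ∀ a → reduce (a mod n) ≡ a mod d
  reduce-mod a = toℕ-injective (begin
    toℕ (toℕ (a mod n) mod d) ≡⟨ toℕ-mod _ d ⟩
    toℕ (a mod n) % d         ≡⟨ %-congˡ (toℕ-mod a n) ⟩
    a % n % d                 ≡⟨ m∣n⇒o%n%m≡o%m d n a d∣n ⟩
    a % d                     ≡⟨ toℕ-mod a d ⟨
    toℕ (a mod d)             ∎)

  reduce-[] : ∀ z → reduce [ z ]ₙ ≡ [ z ]ₙ
  reduce-[] z = toℕ-injective (begin
    toℕ (reduce [ z ]ₙ)       ≡⟨ toℕ-mod _ d ⟩
    toℕ ([_]ₙ {n} z) % d      ≡⟨ %-congˡ (toℕ-[] z n) ⟩
    (z %ℕ n) % d              ≡⟨ ∣⇒%ℕ-≡ d (+ (z %ℕ n)) z d∣r-z ⟩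
    z %ℕ d                    ≡⟨ toℕ-[] z d ⟨
    toℕ ([_]ₙ {d} z)          ∎)
    where
    d∣r-z : + d ℤ∣.∣ + (z %ℕ n) ℤ.- z
    -- A remainder modulo `n` is its own remainder, so it differs from `z` by a multiple of `n`,
    -- hence of `d`. Integer divisibility treats both signs of `z` alike.
    d∣r-z = ℤ∣.∣-trans (∣ᵤ⇒∣ d∣n)
      (%ℕ-≡⇒∣ n (+ (z %ℕ n)) z (m<n⇒m%n≡m (n%ℕd<d z n)))

  reduce-+ : ∀ a b → reduce (a +ₙ b) ≡ reduce a +ₙ reduce b
  reduce-+ a b = trans (reduce-mod (toℕ a + toℕ b)) (toℕ-injective (begin
    toℕ ((toℕ a + toℕ b) mod d)                     ≡⟨ toℕ-mod _ d ⟩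
    (toℕ a + toℕ b) % d                             ≡⟨ %-distribˡ-+ (toℕ a) (toℕ b) d ⟩
    (toℕ a % d + toℕ b % d) % d                     ≡⟨ %-congˡ (cong₂ _+_ (toℕ-mod (toℕ a) d) (toℕ-mod (toℕ b) d)) ⟨
    (toℕ (reduce a) + toℕ (reduce b)) % d           ≡⟨ toℕ-mod _ d ⟨
    toℕ (reduce a +ₙ reduce b)                      ∎))

  reduce-* : ∀ a b → reduce (a *ₙ b) ≡ reduce a *ₙ reduce b
  reduce-* a b = trans (reduce-mod (toℕ a * toℕ b)) (toℕ-injective (begin
    toℕ ((toℕ a * toℕ b) mod d)                     ≡⟨ toℕ-mod _ d ⟩
    (toℕ a * toℕ b) % d                             ≡⟨ %-distribˡ-* (toℕ a) (toℕ b) d ⟩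
    ((toℕ a % d) * (toℕ b % d)) % d                 ≡⟨ %-congˡ (cong₂ _*_ (toℕ-mod (toℕ a) d) (toℕ-mod (toℕ b) d)) ⟨
    (toℕ (reduce a) * toℕ (reduce b)) % d           ≡⟨ toℕ-mod _ d ⟨
    toℕ (reduce a *ₙ reduce b)                      ∎))

  reduce-dot : ∀ {m} (row : Vec ℤ m) x →
               reduce (dot (map [_]ₙ row) x) ≡ dot (map [_]ₙ row) (map reduce x)
  -- The empty sum is `0ₙ`, which is by definition the class of the integer zero.
  reduce-dot []        []      = reduce-[] ℤ.0ℤ
  reduce-dot (z ∷ row) (a ∷ x) = begin
    reduce ([ z ]ₙ *ₙ a +ₙ dot (map [_]ₙ row) x)
      ≡⟨ reduce-+ ([ z ]ₙ *ₙ a) _ ⟩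
    reduce ([ z ]ₙ *ₙ a) +ₙ reduce (dot (map [_]ₙ row) x)
      ≡⟨ cong₂ _+ₙ_ (trans (reduce-* [ z ]ₙ a) (cong (_*ₙ reduce a) (reduce-[] z))) (reduce-dot row x) ⟩
    [ z ]ₙ *ₙ reduce a +ₙ dot (map [_]ₙ row) (map reduce x) ∎

  reduce-· : ∀ {m} (M : Mat m ℤ) x → map reduce (M · x) ≡ M · map reduce x
  reduce-· M x = trans (sym (map-∘ reduce _ M)) (map-cong (λ row → reduce-dot row x) M)

-- Arithmetic of coprime moduli.

-- The square in the second case: if 1 + u ≡ 0 modulo b then u² ≡ 1.
idempotent : ∀ a b .{{_ : NonZero b}} → Coprime a b → ∃[ e ] a ∣ e × e % b ≡ 1 % b
idempotent a b a⊥b with coprime-Bézout a⊥b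
... | Bézout.+- x y 1+yb≡xa = x * a , n∣m*n x , trans (%-congˡ (sym 1+yb≡xa)) ([m+kn]%n≡m%n 1 y b)
... | Bézout.-+ x y 1+xa≡yb = u * u , ∣n⇒∣m*n u (n∣m*n x) , (begin
  (u * u) % b               ≡⟨ [m+kn]%n≡m%n (u * u) y b ⟨
  (u * u + y * b) % b       ≡⟨ %-congˡ (cong (λ v → u * u + v) (sym 1+xa≡yb)) ⟩
  (u * u + (1 + u)) % b     ≡⟨ %-congˡ (factor u) ⟩
  (1 + u * (1 + u)) % b     ≡⟨ %-remove-+ʳ 1 (∣n⇒∣m*n u (divides y 1+xa≡yb)) ⟩
  1 % b                     ∎)
  where
  u = x * a
  factor : ∀ v → v * v + (1 + v) ≡ 1 + v * (1 + v)
  factor = solve-∀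

-- With `k` written as `q * a`, coprimality forces `b` to divide `q`; multiplying by `a` gives the
-- claim.
coprime-*∣ : ∀ {a b k} → Coprime a b → a ∣ k → b ∣ k → a * b ∣ k
coprime-*∣ {a} {b} a⊥b (divides-refl q) b∣qa =
  subst (a * b ∣_) (*-comm a q)
    (*-monoʳ-∣ a (coprime-divisor (Coprimality.sym a⊥b) (subst (b ∣_) (*-comm q a) b∣qa)))

-- Modulo `d` the factor `e` acts as one and `f` as zero, so the first coefficient is read off.
combination-% : ∀ a c {e f} d .{{_ : NonZero d}} → e % d ≡ 1 % d → d ∣ f →
                (a * e + c * f) % d ≡ a % d
combination-% a c {e} {f} d e≡1 d∣f = begin
  (a * e + c * f) % d       ≡⟨ %-remove-+ʳ (a * e) (∣n⇒∣m*n c d∣f) ⟩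
  (a * e) % d               ≡⟨ %-distribˡ-* a e d ⟩
  ((a % d) * (e % d)) % d   ≡⟨ %-congˡ (cong ((a % d) *_) e≡1) ⟩
  ((a % d) * (1 % d)) % d   ≡⟨ %-distribˡ-* a 1 d ⟨
  (a * 1) % d               ≡⟨ %-congˡ (*-identityʳ a) ⟩
  a % d                     ∎

-- Passage from single entries to vectors.

module _ {A B C : Set} {f : A → B} {g : A → C} where

  map-jointly-injective : (∀ {a b} → f a ≡ f b → g a ≡ g b → a ≡ b) →
    ∀ {m} {x y : Vec A m} → map f x ≡ map f y → map g x ≡ map g y → x ≡ y
  map-jointly-injective inj {x = []}    {[]}    _  _  = refl
  map-jointly-injective inj {x = _ ∷ _} {_ ∷ _} fs gs
    with f≡ , fs′ ← ∷-injective fs | g≡ , gs′ ← ∷-injective gs =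
    cong₂ _∷_ (inj f≡ g≡) (map-jointly-injective inj fs′ gs′)

module _ {A B C : Set} {h : B → C → A} where

  map-zipWith-inverseˡ : {f : A → B} → (∀ b c → f (h b c) ≡ b) →
    ∀ {m} (u : Vec B m) (v : Vec C m) → map f (zipWith h u v) ≡ u
  map-zipWith-inverseˡ inv []      []      = refl
  map-zipWith-inverseˡ inv (b ∷ u) (c ∷ v) = cong₂ _∷_ (inv b c) (map-zipWith-inverseˡ inv u v)

  map-zipWith-inverseʳ : {g : A → C} → (∀ b c → g (h b c) ≡ c) →
    ∀ {m} (u : Vec B m) (v : Vec C m) → map g (zipWith h u v) ≡ v
  map-zipWith-inverseʳ inv []      []      = refl
  map-zipWith-inverseʳ inv (b ∷ u) (c ∷ v) = cong₂ _∷_ (inv b c) (map-zipWith-inverseʳ inv u v)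

-- The Chinese remainder bijection on residues.

module ChineseRemainder (n₁ n₂ : ℕ) .{{_ : NonZero n₁}} .{{_ : NonZero n₂}} (n₁⊥n₂ : Coprime n₁ n₂) where

  instance
    n₁n₂≢0 : NonZero (n₁ * n₂)
    n₁n₂≢0 = m*n≢0 n₁ n₂

  module R₁ = Reduction (n₁ * n₂) n₁ (m∣m*n n₂)
  module R₂ = Reduction (n₁ * n₂) n₂ (n∣m*n n₁)

  -- Both moduli divide the difference of the representatives, so by coprimality their product does,
  -- and both representatives lie below that product.
  reduce-jointly-injective : ∀ {a b} → R₁.reduce a ≡ R₁.reduce b → R₂.reduce a ≡ R₂.reduce b → a ≡ b
  reduce-jointly-injective {a} {b} eq₁ eq₂ = toℕ-injective
    (residue-unique (toℕ<n a) (toℕ<n b) (coprime-*∣ n₁⊥n₂ (∣a⊖b n₁ eq₁) (∣a⊖b n₂ eq₂)))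
    where
    ∣a⊖b : ∀ d .{{_ : NonZero d}} → toℕ a mod d ≡ toℕ b mod d → d ∣ ∣ toℕ a ⊖ toℕ b ∣
    ∣a⊖b d eq = %-≡⇒∣⊖ d (toℕ a) (toℕ b)
      (trans (sym (toℕ-mod (toℕ a) d)) (trans (cong toℕ eq) (toℕ-mod (toℕ b) d)))

  -- The multiplier of `a` is 1 modulo `n₁` and 0 modulo `n₂`; the multiplier of `b` is the reverse.
  crt : ℤ/ n₁ → ℤ/ n₂ → ℤ/ (n₁ * n₂)
  crt a b = (toℕ a * proj₁ (idempotent n₂ n₁ (Coprimality.sym n₁⊥n₂))
           + toℕ b * proj₁ (idempotent n₁ n₂ n₁⊥n₂)) mod (n₁ * n₂)

  reduce₁-crt : ∀ a b → R₁.reduce (crt a b) ≡ a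
  reduce₁-crt a b
    -- Abstracting the two multipliers hidden in `crt` puts them in the goal together with their
    -- defining properties.
    with e₁ , _ , e₁≡1 ← idempotent n₂ n₁ (Coprimality.sym n₁⊥n₂) | e₂ , n₁∣e₂ , _ ← idempotent n₁ n₂ n₁⊥n₂ =
    toℕ-injective (begin
      toℕ (R₁.reduce ((toℕ a * e₁ + toℕ b * e₂) mod (n₁ * n₂))) ≡⟨ cong toℕ (R₁.reduce-mod (toℕ a * e₁ + toℕ b * e₂)) ⟩
      toℕ ((toℕ a * e₁ + toℕ b * e₂) mod n₁)                    ≡⟨ toℕ-mod _ n₁ ⟩
      (toℕ a * e₁ + toℕ b * e₂) % n₁                            ≡⟨ combination-% (toℕ a) (toℕ b) n₁ e₁≡1 n₁∣e₂ ⟩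
      toℕ a % n₁                                                ≡⟨ m<n⇒m%n≡m (toℕ<n a) ⟩
      toℕ a                                                     ∎)

  reduce₂-crt : ∀ a b → R₂.reduce (crt a b) ≡ b
  reduce₂-crt a b
    with e₁ , n₂∣e₁ , _ ← idempotent n₂ n₁ (Coprimality.sym n₁⊥n₂) | e₂ , _ , e₂≡1 ← idempotent n₁ n₂ n₁⊥n₂ =
    toℕ-injective (begin
      toℕ (R₂.reduce ((toℕ a * e₁ + toℕ b * e₂) mod (n₁ * n₂))) ≡⟨ cong toℕ (R₂.reduce-mod (toℕ a * e₁ + toℕ b * e₂)) ⟩
      toℕ ((toℕ a * e₁ + toℕ b * e₂) mod n₂)                    ≡⟨ toℕ-mod _ n₂ ⟩
      (toℕ a * e₁ + toℕ b * e₂) % n₂                            ≡⟨ %-congˡ (+-comm (toℕ a * e₁) (toℕ b * e₂)) ⟩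
      -- The summands were swapped so that the multiplier congruent to 1 modulo `n₂` stands first.
      (toℕ b * e₂ + toℕ a * e₁) % n₂                            ≡⟨ combination-% (toℕ b) (toℕ a) n₂ e₂≡1 n₂∣e₁ ⟩
      toℕ b % n₂                                                ≡⟨ m<n⇒m%n≡m (toℕ<n b) ⟩
      toℕ b                                                     ∎)

theorem3p4 : (m : ℕ) .{{_ : NonZero m}} (M : Mat m ℤ)
    (n₁ n₂ : ℕ) .{{_ : NonZero n₁}} .{{_ : NonZero n₂}} →
    gcd n₁ n₂ ≡ 1 →
    moveGraph M (n₁ * n₂) {{m*n≢0 n₁ n₂}} ≅ moveGraph M n₁ ⊗ moveGraph M n₂
theorem3p4 m M n₁ n₂ gcd≡1 = record
  { vertices = mk↔ₛ′
      (λ x → map R₁.reduce x , map R₂.reduce x)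
      (λ (u , v) → zipWith crt u v)
      (λ (u , v) → cong₂ _,_ (section₁ u v) (section₂ u v))
      -- The vector rebuilt from the two reductions of `x` has the same reductions as `x`, so joint
      -- injectivity identifies them.
      (λ x → injective (section₁ (map R₁.reduce x) _) (section₂ _ (map R₂.reduce x)))
  ; arcs = λ x y → mk⇔
      (λ { refl → R₁.reduce-· M x , R₂.reduce-· M x })
      -- Arcs are reflected because `y` and `M · x` have equal reductions modulo both `n₁` and `n₂`.
      (λ (y₁ , y₂) → injective (trans y₁ (sym (R₁.reduce-· M x))) (trans y₂ (sym (R₂.reduce-· M x))))
  }
  where
  open ChineseRemainder n₁ n₂ (gcd≡1⇒coprime gcd≡1)

  injective : ∀ {k} {x y : Vec (ℤ/ (n₁ * n₂)) k} →
              map R₁.reduce x ≡ map R₁.reduce y → map R₂.reduce x ≡ map R₂.reduce y → x ≡ y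
  injective = map-jointly-injective reduce-jointly-injective

  section₁ : ∀ {k} (u : Vec (ℤ/ n₁) k) v → map R₁.reduce (zipWith crt u v) ≡ u
  section₁ = map-zipWith-inverseˡ reduce₁-crt

  section₂ : ∀ {k} (u : Vec (ℤ/ n₁) k) v → map R₂.reduce (zipWith crt u v) ≡ v
  section₂ = map-zipWith-inverseʳ reduce₂-crt
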